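{- Let $n\ge 2$ and let $\mathcal{T}=\mathcal{U}/\Lambda$ be a cubic regular $(n+1)$-toroid, with flags labelled by triples $(\sigma,\mathbf{x},t)$ as described in the context, and let $X_0$ be the base vertex (the vertex of the base flag $\Phi_0=(\mathrm{id},(1,\dots,1),0)$). Let $\Phi=(\sigma,\mathbf{x},t)$ be a flag with $\mathbf{x}=(x_1,\dots,x_n)$. Then $\Phi$ contains $X_0$ if and only if $t$ is the class modulo $\Lambda$ of a vector $(t_1,\dots,t_n)$ with every $t_i\in\{0,-1\}$ and with $t_i=-1$ exactly when $x_i=-1$.
   Context: Here $\mathcal{U}=\{4,3^{n-2},4\}$ is the cubic tessellation of $\mathbb{E}^n$ and $\Lambda$ is one of the lattices $a\mathbb{Z}^n$, $a\{x\in\mathbb{Z}^n:\sum x_i\text{ even}\}$, $a\{x\in\mathbb{Z}^n:\text{all }x_i\text{ of equal parity}\}$ for a positive integer $a$. The flags of $\mathcal{T}$ are identified with the triples $(\sigma,\mathbf{x},t)\in S_n\times\{\pm1\}^n\times(\mathbb{Z}^n/\Lambda)$ (the flag $\Phi_0\gamma$ where $\gamma=\sigma\cdot\mathbf{x}\cdot t\in\mathrm{Aut}(\mathcal{T})\cong(S_n\ltimes C_2^n)\ltimes\mathbb{Z}^n/\Lambda$). Permutations act on $\{1,\dots,n\}$ on the right ($j\mapsto j\sigma$), with $j(\sigma\tau)=(j\sigma)\tau$. For $\mathbf{x}\in\{\pm1\}^n$ and $i\in\{1,\dots,n\}$, $\mathbf{x}^{(i)}$ denotes $\mathbf{x}$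 with its $i$-th coordinate negated; $e_i$ is the $i$-th standard basis vector. The flag-adjacency (monodromy) permutations $r_0,\dots,r_n$ act on flags by: $r_0(\sigma,\mathbf{x},t)=(\sigma,\mathbf{x}^{(1\sigma)},t)$; $r_i(\sigma,\mathbf{x},t)=((i\ i{+}1)\sigma,\mathbf{x},t)$ for $1\le i\le n-1$; $r_n(\sigma,\mathbf{x},t)=(\sigma,\mathbf{x}^{(n\sigma)},t-x_{n\sigma}e_{n\sigma})$; here $r_i\Phi$ is the unique flag differing from $\Phi$ exactly in its face of rank $i$. A flag $\Phi$ contains the vertex $X_0$ iff $\Phi$ lies in the orbit of $\Phi_0$ under $\langle r_1,\dots,r_n\rangle$. -}

module Defs where

open import Data.Nat as ℕ using (ℕ; zero; suc)
open import Data.Integer as ℤ using (ℤ; +_; _◃_)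
open import Data.Integer.Divisibility using (_∣_)
open import Data.Fin using (Fin; zero; suc; toℕ; _≟_)
open import Data.Fin.Permutation using (Permutation′; _⟨$⟩ʳ_; _∘ₚ_; transpose; id)
open import Data.Sign as Sign using (Sign; opposite)
open import Data.Product using (Σ; ∃; _×_; _,_)
open import Relation.Nullary using (yes; no)
open import Relation.Binary.PropositionalEquality using (_≡_)

-- Vectors of ℤ^n, signs {±1}^n, permutations of {0,…,n-1} (0-indexed
-- version of {1,…,n}).
ZVec : ℕ → Set
ZVec n = Fin n → ℤ

SVec : ℕ → Set
SVec n = Fin n → Sign

sumℤ : ∀ {n} → ZVec n → ℤ
sumℤ {zero}  v = + 0
sumℤ {suc n} v = v zero ℤ.+ sumℤ (λ i → v (suc i))

-- The three families of lattices Λ (scaled by a positive integer a).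
data LatticeKind : Set where
  cubic       : LatticeKind   -- a ℤ^n
  evenSum     : LatticeKind   -- a {x ∈ ℤ^n : Σ x_i even}
  equalParity : LatticeKind   -- a {x ∈ ℤ^n : all x_i of equal parity}

InΛ : ∀ {n} → LatticeKind → ℕ → ZVec n → Set
InΛ {n} cubic a v =
  Σ (ZVec n) λ y → ∀ i → v i ≡ + a ℤ.* y i
InΛ {n} evenSum a v =
  Σ (ZVec n) λ y → (∀ i → v i ≡ + a ℤ.* y i) × (+ 2 ∣ sumℤ y)
InΛ {n} equalParity a v =
  Σ (ZVec n) λ y → (∀ i → v i ≡ + a ℤ.* y i) × (∀ i j → + 2 ∣ (y i ℤ.- y j))

-- t ≡ t' (mod Λ)
_≡[_,_]_ : ∀ {n} → ZVec n → LatticeKind → ℕ → ZVec n → Set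
t ≡[ k , a ] t' = InΛ k a (λ i → t i ℤ.- t' i)

-- x^{(i)} : negate coordinate i
negateAt : ∀ {n} → SVec n → Fin n → SVec n
negateAt x i j with j ≟ i
... | yes _ = opposite (x j)
... | no  _ = x j

-- t - c e_i
subAt : ∀ {n} → ZVec n → Fin n → ℤ → ZVec n
subAt t i c j with j ≟ i
... | yes _ = t j ℤ.- c
... | no  _ = t j

-- Flags, with t a representative in ℤ^n of its class in ℤ^n/Λ.
record Flag (n : ℕ) : Set where
  constructor flag
  field
    σ : Permutation′ n
    x : SVec n
    t : ZVec n

-- the sign x_i as the integer ±1
sgn : Sign → ℤ
sgn s = s ◃ 1

-- Orbit of the base flag Φ₀ = (id, (1,…,1), 0) under ⟨r₁,…,rₙ⟩, computed on
-- representatives in ℤ^n.  (Ranks 1..n; with 0-indexed coordinates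
-- r_i (1 ≤ i ≤ n-1) swaps coordinates i-1 and i, and r_n uses coordinate
-- n-1, i.e. the last one.)  j σ is written σ ⟨$⟩ʳ j, and (i i+1)σ is
-- transpose i i+1 ∘ₚ σ  (since (π ∘ₚ ρ) ⟨$⟩ʳ j = ρ ⟨$⟩ʳ (π ⟨$⟩ʳ j)).
data Reach {n : ℕ} : Flag n → Set where
  base : Reach (flag id (λ _ → Sign.+) (λ _ → + 0))
  r-mid : ∀ {σ x t} (i j : Fin n) → toℕ j ≡ suc (toℕ i) →
          Reach (flag σ x t) → Reach (flag (transpose i j ∘ₚ σ) x t)
  r-top : ∀ {σ x t} (k : Fin n) → suc (toℕ k) ≡ n →
          Reach (flag σ x t) →
          Reach (flag σ (negateAt x (σ ⟨$⟩ʳ k))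
                      (subAt t (σ ⟨$⟩ʳ k) (sgn (x (σ ⟨$⟩ʳ k)))))

-- Φ = (σ, x, [t]) contains the base vertex X₀ iff the flag (σ, x, t mod Λ)
-- lies in the ⟨r₁,…,rₙ⟩-orbit of Φ₀ in the toroid 𝒰/Λ: some reachable
-- representative agrees with it (σ as a permutation, x pointwise, t mod Λ).
ContainsBaseVertex : ∀ {n} → LatticeKind → ℕ → Flag n → Set
ContainsBaseVertex {n} k a (flag σ x t) =
  ∃ λ (Ψ : Flag n) → Reach Ψ ×
    ((∀ j → Flag.σ Ψ ⟨$⟩ʳ j ≡ σ ⟨$⟩ʳ j) × (∀ j → Flag.x Ψ j ≡ x j) ×
     (Flag.t Ψ ≡[ k , a ] t))

-- The vertex X₀ is the origin, and the flags containing it correspond to the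
-- unit cubes around the origin together with a flag of each such cube.  In
-- the orbit of Φ₀ under ⟨r₁,…,rₙ⟩ the translation part is therefore always
-- the corner of [-1,0]ⁿ picked out by the signs: r₁,…,rₙ₋₁ change neither,
-- and rₙ negates one sign xᵢ while moving tᵢ by -xᵢ, from 0 to -1 or back.
-- Conversely the adjacent transpositions r₁,…,rₙ₋₁ reach every σ, and
-- conjugating rₙ by them negates any chosen sign, so every pair (σ, x)
-- occurs in the orbit.
module Submission where

open import Defs
open import Data.Nat using (ℕ; _≤_)
open import Data.Integer using (ℤ; +_; -[1+_])
open import Data.Sign using (Sign)
open import Data.Fin.Permutation using (Permutation′)
open import Data.Product using (Σ; _×_)
open import Data.Sum using (_⊎_)
open import Relation.Binary.PropositionalEquality using (_≡_)
open import Function.Bundles using (_⇔_)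

open import Data.Nat using (zero; suc; _<_; _∸_; z≤n)
import Data.Nat as ℕ
import Data.Nat.Properties as ℕ
import Data.Nat.Divisibility as ℕ
open import Data.Integer using (_+_; _*_; _-_; -_; ∣_∣)
import Data.Integer.Properties as ℤ
open import Data.Integer.Divisibility using (_∣_)
open import Data.Fin as Fin using (Fin; toℕ; fromℕ; fromℕ<)
import Data.Fin.Properties as Fin
open import Data.Fin.Permutation
  using (_⟨$⟩ʳ_; _⟨$⟩ˡ_; _∘ₚ_; _≈_; transpose; inverseˡ; inverseʳ)
open import Data.Sign using (opposite)
import Data.Sign.Properties as Sign
open import Data.Product using (_,_; Σ-syntax)
open import Data.Sum using (inj₁; inj₂)
open import Function.Base using (_∘_)
open import Function.Bundles using (mk⇔; Equivalence)
open import Relation.Nullary using (yes; no; contradiction)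
open import Relation.Binary.PropositionalEquality
  using (_≢_; refl; sym; trans; cong; subst; module ≡-Reasoning)

open ≡-Reasoning

InΛ-cong : ∀ {n} k a {v w : ZVec n} → (∀ i → v i ≡ w i) → InΛ k a v → InΛ k a w
InΛ-cong cubic       a v≗w (y , v≡ay)     = y , λ i → trans (sym (v≗w i)) (v≡ay i)
InΛ-cong evenSum     a v≗w (y , v≡ay , p) = y , (λ i → trans (sym (v≗w i)) (v≡ay i)) , p
InΛ-cong equalParity a v≗w (y , v≡ay , p) = y , (λ i → trans (sym (v≗w i)) (v≡ay i)) , p

sumℤ-neg : ∀ {n} (y : ZVec n) → sumℤ (λ i → - y i) ≡ - sumℤ y
sumℤ-neg {zero}  y = refl
sumℤ-neg {suc n} y = begin
  - y Fin.zero + sumℤ (λ i → - y (Fin.suc i))   ≡⟨ cong (λ s → - y Fin.zero + s) (sumℤ-neg (y ∘ Fin.suc)) ⟩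
  - y Fin.zero + - sumℤ (λ i → y (Fin.suc i))   ≡⟨ ℤ.neg-distrib-+ (y Fin.zero) _ ⟨
  - sumℤ y                                      ∎

∣-neg : ∀ {d} z → d ∣ z → d ∣ - z
∣-neg {d} z = subst (∣ d ∣ ℕ.∣_) (sym (ℤ.∣-i∣≡∣i∣ z))

neg-minus : ∀ i j → - (i - j) ≡ j - i
neg-minus i j = begin
  - (i - j)      ≡⟨ ℤ.neg-distrib-+ i (- j) ⟩
  - i + - - j    ≡⟨ cong (λ s → - i + s) (ℤ.neg-involutive j) ⟩
  - i + j        ≡⟨ ℤ.+-comm (- i) j ⟩
  j - i          ∎

neg-scaled : ∀ {n} a {v y : ZVec n} → (∀ i → v i ≡ + a * y i) → ∀ i → - v i ≡ + a * - y i
neg-scaled a v≡ay i = trans (cong -_ (v≡ay i)) (ℤ.neg-distribʳ-* (+ a) _)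

InΛ-neg : ∀ {n} k a {v : ZVec n} → InΛ k a v → InΛ k a (λ i → - v i)
InΛ-neg cubic a (y , v≡ay) = (λ i → - y i) , neg-scaled a v≡ay
InΛ-neg evenSum a (y , v≡ay , 2∣Σy) =
  (λ i → - y i) , neg-scaled a v≡ay , subst (+ 2 ∣_) (sym (sumℤ-neg y)) (∣-neg {+ 2} (sumℤ y) 2∣Σy)
InΛ-neg equalParity a (y , v≡ay , 2∣yᵢ-yⱼ) =
  (λ i → - y i) , neg-scaled a v≡ay ,
  λ i j → subst (+ 2 ∣_) (ℤ.neg-distrib-+ (y i) (- y j)) (∣-neg {+ 2} (y i - y j) (2∣yᵢ-yⱼ i j))

≡Λ-sym : ∀ {n} k a {u w : ZVec n} → u ≡[ k , a ] w → w ≡[ k , a ] u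
≡Λ-sym k a {u} {w} = InΛ-cong k a (λ i → neg-minus (u i) (w i)) ∘ InΛ-neg k a

≡Λ-respˡ : ∀ {n} k a {u u′ w : ZVec n} → (∀ i → u i ≡ u′ i) →
           u ≡[ k , a ] w → u′ ≡[ k , a ] w
≡Λ-respˡ k a {w = w} u≗u′ = InΛ-cong k a (λ i → cong (_- w i) (u≗u′ i))

corner : Sign → ℤ
corner Sign.+ = + 0
corner Sign.- = -[1+ 0 ]

CornerOf : Sign → ℤ → Set
CornerOf s z = (z ≡ + 0 ⊎ z ≡ -[1+ 0 ]) × (z ≡ -[1+ 0 ] ⇔ s ≡ Sign.-)

cornerOf⇔≡corner : ∀ s z → CornerOf s z ⇔ z ≡ corner s
cornerOf⇔≡corner s z = mk⇔ (to s z) (λ { refl → from s })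
  where
  to : ∀ s z → CornerOf s z → z ≡ corner s
  to Sign.+ _ (inj₁ refl , _) = refl
  to Sign.+ _ (inj₂ refl , z≡-1⇔s≡-) with Equivalence.to z≡-1⇔s≡- refl
  ... | ()
  to Sign.- _ (_ , z≡-1⇔s≡-) = Equivalence.from z≡-1⇔s≡- refl
  from : ∀ s → CornerOf s (corner s)
  from Sign.+ = inj₁ refl , mk⇔ (λ ()) (λ ())
  from Sign.- = inj₂ refl , mk⇔ (λ _ → refl) (λ _ → refl)

corner-opposite : ∀ s → corner s - sgn s ≡ corner (opposite s)
corner-opposite Sign.+ = refl
corner-opposite Sign.- = refl

reach⇒t≡corner : ∀ {n} {Φ : Flag n} → Reach Φ → ∀ i → Flag.t Φ i ≡ corner (Flag.x Φ i)
reach⇒t≡corner base _ = refl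
reach⇒t≡corner (r-mid _ _ _ R) = reach⇒t≡corner R
reach⇒t≡corner (r-top {σ} {x} {t} k _ R) i = flipped (σ ⟨$⟩ʳ k)
  where
  flipped : ∀ c → subAt t c (sgn (x c)) i ≡ corner (negateAt x c i)
  flipped c with i Fin.≟ c
  ... | yes refl = trans (cong (_- sgn (x i)) (reach⇒t≡corner R i)) (corner-opposite (x i))
  ... | no  _    = reach⇒t≡corner R i

transpose-matchʳ : ∀ {n} (i j : Fin n) → transpose i j ⟨$⟩ʳ j ≡ i
transpose-matchʳ i j with j Fin.≟ i
... | yes j≡i = j≡i
... | no  _ with j Fin.≟ j
...   | yes _   = refl
...   | no  j≢j = contradiction refl j≢j

transpose-mismatch : ∀ {n} (i j k : Fin n) → i ≢ k → j ≢ k → transpose i j ⟨$⟩ʳ k ≡ k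
transpose-mismatch i j k i≢k j≢k with k Fin.≟ i
... | yes k≡i = contradiction (sym k≡i) i≢k
... | no  _ with k Fin.≟ j
...   | yes k≡j = contradiction (sym k≡j) j≢k
...   | no  _   = refl

⟨$⟩ʳ-injective : ∀ {n} (π : Permutation′ n) {i j} → π ⟨$⟩ʳ i ≡ π ⟨$⟩ʳ j → i ≡ j
⟨$⟩ʳ-injective π πi≡πj = trans (sym (inverseˡ π)) (trans (cong (π ⟨$⟩ˡ_) πi≡πj) (inverseˡ π))

negateAt-self : ∀ {n} (x : SVec n) c → negateAt x c c ≡ opposite (x c)
negateAt-self x c with c Fin.≟ c
... | yes _   = refl
... | no  c≢c = contradiction refl c≢c

negateAt-other : ∀ {n} (x : SVec n) c j → j ≢ c → negateAt x c j ≡ x j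
negateAt-other x c j j≢c with j Fin.≟ c
... | yes j≡c = contradiction j≡c j≢c
... | no  _   = refl

opposite-≢ : ∀ {s s′} → s ≢ s′ → opposite s ≡ s′
opposite-≢ {Sign.+} {Sign.+} s≢s′ = contradiction refl s≢s′
opposite-≢ {Sign.+} {Sign.-} _    = refl
opposite-≢ {Sign.-} {Sign.+} _    = refl
opposite-≢ {Sign.-} {Sign.-} s≢s′ = contradiction refl s≢s′

module _ {n : ℕ} {x : SVec n} {t : ZVec n} where

  Reachable : (Permutation′ n → Set) → Set
  Reachable P = Σ[ ρ ∈ Permutation′ n ] Reach (flag ρ x t) × P ρ

  EntryMoved : Permutation′ n → Fin n → Fin n → Permutation′ n → Set
  EntryMoved σ p m ρ = ρ ⟨$⟩ʳ m ≡ σ ⟨$⟩ʳ p × (∀ j → m Fin.< j → ρ ⟨$⟩ʳ j ≡ σ ⟨$⟩ʳ j)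

  moveUpOne : ∀ {σ p} m′ m → toℕ m ≡ suc (toℕ m′) →
              Reachable (EntryMoved σ p m′) → Reachable (EntryMoved σ p m)
  moveUpOne m′ m m≡1+m′ (ρ , R , ρm′≡σp , ρ≡σ-above-m′) =
    transpose m′ m ∘ₚ ρ , r-mid m′ m m≡1+m′ R ,
    trans (cong (ρ ⟨$⟩ʳ_) (transpose-matchʳ m′ m)) ρm′≡σp ,
    λ j m<j → let m′<j = Fin.<-trans m′<m m<j in
      trans (cong (ρ ⟨$⟩ʳ_) (transpose-mismatch m′ m j (Fin.<⇒≢ m′<j) (Fin.<⇒≢ m<j)))
            (ρ≡σ-above-m′ j m′<j)
    where
    m′<m : m′ Fin.< m
    m′<m = ℕ.≤-reflexive (sym m≡1+m′)

  moveUp : ∀ {σ} → Reach (flag σ x t) → (p m : Fin n) → p Fin.≤ m →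
           Reachable (EntryMoved σ p m)
  moveUp {σ} R p m p≤m = go (toℕ m ∸ toℕ p) m (sym (ℕ.m∸n+n≡m p≤m))
    where
    go : (d : ℕ) (m : Fin n) → toℕ m ≡ d ℕ.+ toℕ p → Reachable (EntryMoved σ p m)
    go zero m m≡p with Fin.toℕ-injective m≡p
    ... | refl = σ , R , refl , λ _ _ → refl
    go (suc d) m m≡1+d+p = moveUpOne {σ} {p} m′ m m≡1+m′ (go d m′ (Fin.toℕ-fromℕ< m′<n))
      where
      m′<n : d ℕ.+ toℕ p < n
      m′<n = ℕ.<⇒≤ (subst (_< n) m≡1+d+p (Fin.toℕ<n m))
      m′ : Fin n
      m′ = fromℕ< m′<n
      m≡1+m′ : toℕ m ≡ suc (toℕ m′)
      m≡1+m′ = trans m≡1+d+p (cong suc (sym (Fin.toℕ-fromℕ< m′<n)))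

  AgreesFrom : ℕ → Permutation′ n → Permutation′ n → Set
  AgreesFrom m τ σ = ∀ j → m ≤ toℕ j → σ ⟨$⟩ʳ j ≡ τ ⟨$⟩ʳ j

  agreeOneLower : ∀ {m} τ → m < n → Reachable (AgreesFrom (suc m) τ) → Reachable (AgreesFrom m τ)
  agreeOneLower {m} τ m<n (σ , R , σ≡τ-above-m) = settle (moveUp R p q p≤q)
    where
    q : Fin n
    q = fromℕ< m<n
    q≡m : toℕ q ≡ m
    q≡m = Fin.toℕ-fromℕ< m<n
    p : Fin n
    p = σ ⟨$⟩ˡ (τ ⟨$⟩ʳ q)
    σp≡τq : σ ⟨$⟩ʳ p ≡ τ ⟨$⟩ʳ q
    σp≡τq = inverseʳ σ
    p≤q : p Fin.≤ q
    p≤q = ℕ.≮⇒≥ λ q<p → Fin.<⇒≢ q<p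
      (⟨$⟩ʳ-injective τ (trans (sym σp≡τq) (σ≡τ-above-m p (subst (_< toℕ p) q≡m q<p))))
    settle : Reachable (EntryMoved σ p q) → Reachable (AgreesFrom m τ)
    settle (ρ , R′ , ρq≡σp , ρ≡σ-above-q) = ρ , R′ , ρ≡τ-from-m
      where
      ρ≡τ-from-m : AgreesFrom m τ ρ
      ρ≡τ-from-m j m≤j with ℕ.m≤n⇒m<n∨m≡n m≤j
      ... | inj₁ m<j = trans (ρ≡σ-above-q j (subst (_< toℕ j) (sym q≡m) m<j)) (σ≡τ-above-m j m<j)
      ... | inj₂ m≡j with Fin.toℕ-injective (trans q≡m m≡j)
      ...   | refl = trans ρq≡σp σp≡τq

  arrangeBelow : ∀ m τ → m ≤ n → Reachable (AgreesFrom m τ) → Reachable (_≈ τ)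
  arrangeBelow zero    τ _   (σ , R , σ≡τ) = σ , R , λ j → σ≡τ j z≤n
  arrangeBelow (suc m) τ m<n reachable =
    arrangeBelow m τ (ℕ.<⇒≤ m<n) (agreeOneLower τ m<n reachable)

  anyArrangement : ∀ {σ} → Reach (flag σ x t) → (τ : Permutation′ n) → Reachable (_≈ τ)
  anyArrangement {σ} R τ =
    arrangeBelow n τ ℕ.≤-refl (σ , R , λ j n≤j → contradiction n≤j (ℕ.<⇒≱ (Fin.toℕ<n j)))

module _ {n : ℕ} where

  flipSign : ∀ {σ x t} → Reach (flag σ x t) → (c : Fin (suc n)) →
             Σ[ Ψ ∈ Flag (suc n) ] Reach Ψ × (∀ j → Flag.x Ψ j ≡ negateAt x c j)
  flipSign {x = x} R c with anyArrangement R (transpose c (fromℕ n))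
  ... | ρ , R′ , ρ≈τ =
    _ , r-top (fromℕ n) (cong suc (Fin.toℕ-fromℕ n)) R′ ,
    λ j → cong (λ c′ → negateAt x c′ j) (trans (ρ≈τ (fromℕ n)) (transpose-matchʳ c (fromℕ n)))

  setSign : ∀ {Φ : Flag (suc n)} → Reach Φ → (c : Fin (suc n)) (s : Sign) →
            Σ[ Ψ ∈ Flag (suc n) ] Reach Ψ × Flag.x Ψ c ≡ s ×
                                  (∀ j → j ≢ c → Flag.x Ψ j ≡ Flag.x Φ j)
  setSign {Φ} R c s with Flag.x Φ c Sign.≟ s
  ... | yes xc≡s = Φ , R , xc≡s , λ _ _ → refl
  ... | no  xc≢s with flipSign R c
  ...   | Ψ , R′ , Ψx≡negated =
    Ψ , R′ , trans (Ψx≡negated c) (trans (negateAt-self (Flag.x Φ) c) (opposite-≢ xc≢s)) ,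
    λ j j≢c → trans (Ψx≡negated j) (negateAt-other (Flag.x Φ) c j j≢c)

  signsAgreeBelow : ∀ (x : SVec (suc n)) m → m ≤ suc n →
    Σ[ Ψ ∈ Flag (suc n) ] Reach Ψ × (∀ j → toℕ j < m → Flag.x Ψ j ≡ x j)
  signsAgreeBelow x zero    _   = _ , base , λ _ ()
  signsAgreeBelow x (suc m) m<n with signsAgreeBelow x m (ℕ.<⇒≤ m<n)
  ... | Φ , R , Φx≡x-below-m with setSign R (fromℕ< m<n) (x (fromℕ< m<n))
  ...   | Ψ , R′ , Ψxc≡xc , Ψx≡Φx-elsewhere = Ψ , R′ , Ψx≡x-below-1+m
    where
    c≡m : toℕ (fromℕ< m<n) ≡ m
    c≡m = Fin.toℕ-fromℕ< m<n
    Ψx≡x-below-1+m : ∀ j → toℕ j < suc m → Flag.x Ψ j ≡ x j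
    Ψx≡x-below-1+m j j<1+m with ℕ.m<1+n⇒m<n∨m≡n j<1+m
    ... | inj₁ j<m = trans (Ψx≡Φx-elsewhere j (λ j≡c → ℕ.<-irrefl (trans (cong toℕ j≡c) c≡m) j<m))
                           (Φx≡x-below-m j j<m)
    ... | inj₂ j≡m with Fin.toℕ-injective (trans j≡m (sym c≡m))
    ...   | refl = Ψxc≡xc

  reachable : (σ : Permutation′ (suc n)) (x : SVec (suc n)) →
    Σ[ Ψ ∈ Flag (suc n) ] Reach Ψ × Flag.σ Ψ ≈ σ × (∀ j → Flag.x Ψ j ≡ x j)
  reachable σ x with signsAgreeBelow x (suc n) ℕ.≤-refl
  ... | Φ , R , Φx≡x with anyArrangement R σ
  ...   | ρ , R′ , ρ≈σ = flag ρ (Flag.x Φ) (Flag.t Φ) , R′ , ρ≈σ , λ j → Φx≡x j (Fin.toℕ<n j)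

lemma5p1 : (n : ℕ) → 2 ≤ n → (k : LatticeKind) → (a : ℕ) → 1 ≤ a →
    (σ : Permutation′ n) (x : SVec n) (t : ZVec n) →
    ContainsBaseVertex k a (flag σ x t) ⇔
      Σ (ZVec n) (λ t₀ →
        (∀ i → (t₀ i ≡ + 0 ⊎ t₀ i ≡ -[1+ 0 ]) × (t₀ i ≡ -[1+ 0 ] ⇔ x i ≡ Sign.-))
        × (t ≡[ k , a ] t₀))
lemma5p1 (suc n) _ k a _ σ x t = mk⇔ atBase⇒corner corner⇒atBase
  where
  Corners : ZVec (suc n) → Set
  Corners t₀ = ∀ i → CornerOf (x i) (t₀ i)

  reach⇒t≡cornerOfx : ∀ {Ψ} → Reach Ψ → (∀ j → Flag.x Ψ j ≡ x j) → ∀ i → Flag.t Ψ i ≡ corner (x i)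
  reach⇒t≡cornerOfx R Ψx≡x i = trans (reach⇒t≡corner R i) (cong corner (Ψx≡x i))

  atBase⇒corner : ContainsBaseVertex k a (flag σ x t) → Σ[ t₀ ∈ ZVec (suc n) ] Corners t₀ × t ≡[ k , a ] t₀
  atBase⇒corner (Ψ , R , _ , Ψx≡x , Ψt≡t) =
    Flag.t Ψ ,
    (λ i → Equivalence.from (cornerOf⇔≡corner (x i) _) (reach⇒t≡cornerOfx R Ψx≡x i)) ,
    ≡Λ-sym k a {Flag.t Ψ} Ψt≡t

  corner⇒atBase : Σ[ t₀ ∈ ZVec (suc n) ] Corners t₀ × t ≡[ k , a ] t₀ → ContainsBaseVertex k a (flag σ x t)
  corner⇒atBase (t₀ , t₀-corners , t≡t₀) with reachable σ x
  ... | Ψ , R , Ψσ≈σ , Ψx≡x = Ψ , R , Ψσ≈σ , Ψx≡x , ≡Λ-respˡ k a t₀≡Ψt (≡Λ-sym k a {t} t≡t₀)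
    where
    t₀≡Ψt : ∀ i → t₀ i ≡ Flag.t Ψ i
    t₀≡Ψt i = trans (Equivalence.to (cornerOf⇔≡corner (x i) (t₀ i)) (t₀-corners i))
                    (sym (reach⇒t≡cornerOfx R Ψx≡x i))
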